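{- Let $n\ge 3$, $1\le t<n$, and let $c_1,c_2,\ldots,c_t\in[n]$ be distinct integers such that the sequence $(c_1,\ldots,c_t)$ avoids both patterns $123$ and $312$. If $\{c_1,\ldots,c_t\}$ is a set of consecutive integers, then $$|S_{n,(c_1,\ldots,c_t)}(123,312)|\in\bigl\{0,\ 1,\ \min\{c_1,\ldots,c_t\}\bigr\};$$ otherwise, $|S_{n,(c_1,\ldots,c_t)}(123,312)|\in\{0,1\}$.
   Context: $[n]=\{1,\ldots,n\}$ and $S_n$ is the set of permutations of $[n]$ written as sequences $(\tau(1),\ldots,\tau(n))$. A sequence of distinct integers $\tau=(\tau(1),\ldots,\tau(m))$ contains $\sigma\in S_k$ as a pattern if there are indices $1\le i_1<\cdots<i_k\le m$ such that for all $1\le a<b\le k$, $\tau(i_a)<\tau(i_b)$ if and only if $\sigma(a)<\sigma(b)$; otherwise $\tau$ avoids $\sigma$. $S_{n,(c_1,\ldots,c_t)}(\sigma_1,\ldots,\sigma_m)$ is the set of $\tau\in S_n$ with $(\tau(1),\ldots,\tau(t))=(c_1,\ldots,c_t)$ that avoid all of $\sigma_1,\ldots,\sigma_m$. A set of $t$ integers is a set of consecutive integers if it equals $\{x,x+1,\ldots,x+t-1\}$ for some $x$. -}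

module Defs where

open import Data.Fin using (Fin) renaming (_<_ to _<ᶠ_)
open import Data.List using (List; []; _∷_; length; lookup; take; applyUpTo)
open import Data.List.Extrema.Nat using (min)
open import Data.List.Membership.Propositional using (_∈_)
open import Data.List.Relation.Binary.Permutation.Propositional using (_↭_)
open import Data.List.Relation.Unary.All using (All)
open import Data.List.Relation.Unary.Unique.Propositional using (Unique)
open import Data.Nat using (ℕ; suc; _+_; _≤_; _<_)
open import Data.Product using (Σ-syntax; ∃-syntax; _×_)
open import Function.Bundles using (_⇔_)
open import Level using (Level; _⊔_)
open import Relation.Binary.PropositionalEquality using (_≡_)
open import Relation.Nullary using (¬_)
open import Relation.Unary using (Pred)

-- Permutations are in one-line notation: the value τ(i), with 1-based i, is
-- the entry of the list at 0-based position i - 1.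
IsPermutation : ℕ → List ℕ → Set
IsPermutation n τ = τ ↭ applyUpTo suc n

Contains : List ℕ → List ℕ → Set
Contains τ σ =
  Σ[ i ∈ (Fin (length σ) → Fin (length τ)) ]
    (∀ a b → a <ᶠ b → i a <ᶠ i b) ×
    (∀ a b → a <ᶠ b →
      (lookup τ (i a) < lookup τ (i b)) ⇔ (lookup σ a < lookup σ b))

Avoids : List ℕ → List ℕ → Set
Avoids τ σ = ¬ Contains τ σ

p123 p312 : List ℕ
p123 = 1 ∷ 2 ∷ 3 ∷ []
p312 = 3 ∷ 1 ∷ 2 ∷ []

-- S n c σs is the set S_{n,(c₁,…,c_t)}(σ₁,…,σ_m), where t = length c.
S : ℕ → List ℕ → List (List ℕ) → Pred (List ℕ) _
S n c σs τ = IsPermutation n τ × take (length c) τ ≡ c × All (Avoids τ) σs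

-- For duplicate-free c, the set of entries of c has exactly length c elements.
-- Its entries being natural numbers, x may be taken in ℕ.
Consecutive : List ℕ → Set
Consecutive c = ∃[ x ] (∀ m → (m ∈ c) ⇔ (x ≤ m × m < x + length c))

-- The value on [] is junk.
minimum : List ℕ → ℕ
minimum []       = 0
minimum (x ∷ xs) = min x xs

-- P has exactly k elements: they can be listed without repetition in a list of
-- length k.  Such a k is unique.
HasCardinality : ∀ {a ℓ : Level} {A : Set a} → Pred A ℓ → ℕ → Set (a ⊔ ℓ)
HasCardinality {A = A} P k =
  Σ[ xs ∈ List A ] Unique xs × length xs ≡ k × (∀ x → (x ∈ xs) ⇔ P x)

{-# OPTIONS --safe #-}

-- Call (b , c) an ascent if b < c and b precedes c.  A duplicate-free τ avoids
-- 123 and 312 iff for every entry a each later ascent (b , c) has b < a < c.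
-- Hence if τ starts with x, the entries below x occur in decreasing order and
-- so do those above x; moreover the latter are contiguous, since once one of
-- them has occurred no ascent can follow.  So τ is x followed by x - 1, …, 1
-- with the block n, …, x + 1 inserted somewhere.  A prefix that reaches the
-- block, or that leaves x, x - 1, …, determines the place of insertion; a
-- prefix x, x - 1, …, m + 1 leaves the m + 1 places after m + 1 (a single
-- permutation if the block is empty).

module Submission where

open import Defs
open import Data.Empty using (⊥-elim)
open import Data.Fin using (Fin; zero; suc) renaming (_<_ to _<ᶠ_)
open import Data.List using (List; []; _∷_; length; lookup; take; map; _++_; applyUpTo; applyDownFrom)
open import Data.List.Extrema.Nat using (min≤⊤; v≤min⁺; min≈v⁺)
open import Data.List.Membership.Propositional using (_∈_)
open import Data.List.Membership.Propositional.Properties using (∈-++⁻; ∈-++⁺ʳ; ∈-map⁺; ∈-map⁻; ∈-lookup; ∈-applyDownFrom⁺; ∈-applyDownFrom⁻)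
open import Data.List.Properties using (≡-dec; length-map; reverse-applyUpTo; ∷-injectiveˡ; ∷-injectiveʳ; tabulate-lookup)
open import Data.List.Relation.Binary.Permutation.Propositional using (_↭_; ↭-refl; ↭-sym; ↭-trans; ↭-reflexive; prep; ↭⇒↭ₛ)
open import Data.List.Relation.Binary.Permutation.Propositional.Properties using (∈-resp-↭; shift; drop-mid; ↭-reverse; ↭-empty-inv)
import Data.List.Relation.Binary.Permutation.Setoid.Properties as ↭ₛ
open import Data.List.Relation.Binary.Pointwise using (Pointwise-≡⇒≡)
open import Data.List.Relation.Unary.All as All using (All; []; _∷_)
open import Data.List.Relation.Unary.AllPairs as AllPairs using (AllPairs; []; _∷_)
import Data.List.Relation.Unary.AllPairs.Properties as AllPairs
open import Data.List.Relation.Unary.Any using (here; there)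
open import Data.List.Relation.Unary.Sorted.TotalOrder.Properties using (↗↭↗⇒≋; AllPairs⇒Sorted)
open import Data.List.Relation.Unary.Unique.Propositional using (Unique)
import Data.List.Relation.Unary.Unique.Propositional.Properties as Unique
open import Data.Nat using (ℕ; zero; suc; _+_; _≤_; _<_; _≥_; _>_; z≤n; s≤s; z<s; s<s; _≟_)
open import Data.Nat.Properties
open import Data.Product using (∃-syntax; _×_; _,_; proj₁; proj₂)
open import Data.Sum using (_⊎_; inj₁; inj₂)
open import Function using (_∘_)
open import Function.Bundles using (_⇔_; mk⇔; Equivalence)
import Relation.Binary.Construct.Flip.EqAndOrd as Flip
open import Relation.Binary.PropositionalEquality using (_≡_; _≢_; refl; sym; trans; cong; cong₂; subst; setoid)
open import Relation.Nullary using (¬_; Dec; yes; no)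
open import Relation.Nullary.Decidable using (map′)
open import Relation.Unary using (Pred)

open Equivalence using (to; from)

-- Finite cardinalities

module _ {a} {A : Set a} where

  card-cong : ∀ {p q} {P : Pred A p} {Q : Pred A q} {k} →
              (∀ x → P x ⇔ Q x) → HasCardinality P k → HasCardinality Q k
  card-cong P⇔Q (xs , xs! , ∣xs∣ , xs⇔P) = xs , xs! , ∣xs∣ , λ x →
    mk⇔ (to (P⇔Q x) ∘ to (xs⇔P x)) (from (xs⇔P x) ∘ from (P⇔Q x))

  card-insert : ∀ {p} {P : Pred A p} {k} {v} → ¬ P v →
                HasCardinality P k → HasCardinality (λ x → x ≡ v ⊎ P x) (suc k)
  card-insert {P = P} {v = v} ¬Pv (xs , xs! , ∣xs∣ , xs⇔P) =
    v ∷ xs , All.tabulate v≢ ∷ xs! , cong suc ∣xs∣ , λ x → mk⇔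
      (λ { (here refl) → inj₁ refl ; (there x∈xs) → inj₂ (to (xs⇔P x) x∈xs) })
      (λ { (inj₁ refl) → here refl ; (inj₂ Px) → there (from (xs⇔P x) Px) })
    where
    v≢ : ∀ {x} → x ∈ xs → v ≢ x
    v≢ x∈xs refl = ¬Pv (to (xs⇔P v) x∈xs)

  card-⊆-singleton : ∀ {p} {P : Pred A p} v → (∀ {x} → P x → x ≡ v) → Dec (P v) →
                     ∃[ k ] HasCardinality P k × k ∈ 0 ∷ 1 ∷ []
  card-⊆-singleton v P⊆v (yes Pv) =
    1 , (v ∷ [] , [] ∷ [] , refl , λ _ → mk⇔ (λ { (here refl) → Pv }) (here ∘ P⊆v)) , there (here refl)
  card-⊆-singleton {P = P} v P⊆v (no ¬Pv) =
    0 , ([] , [] , refl , λ _ → mk⇔ (λ ()) (λ Px → ⊥-elim (¬Pv (subst P (P⊆v Px) Px)))) , here refl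

  card-map-∷ : ∀ {p} {P : Pred (List A) p} {k} x → HasCardinality P k →
               HasCardinality (λ τ → ∃[ w ] τ ≡ x ∷ w × P w) k
  card-map-∷ x (xs , xs! , ∣xs∣ , xs⇔P) =
    map (x ∷_) xs , Unique.map⁺ ∷-injectiveʳ xs! , trans (length-map _ xs) ∣xs∣ , λ τ → mk⇔
      (λ τ∈ → let w , w∈ , eq = ∈-map⁻ (x ∷_) τ∈ in w , eq , to (xs⇔P w) w∈)
      (λ { (w , refl , Pw) → ∈-map⁺ (x ∷_) (from (xs⇔P w) Pw) })

-- Descending lists

-- The run `m + l , … , m + 1`; in particular `seg 0 y` is `y , … , 1`.
seg : ℕ → ℕ → List ℕ
seg m l = applyDownFrom (λ i → suc (m + i)) l

∈-seg : ∀ {m l v} → v ∈ seg m l ⇔ (suc m ≤ v × v < suc m + l)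
∈-seg {m} {l} {v} = mk⇔ ⇒ ⇐
  where
  ⇒ : v ∈ seg m l → suc m ≤ v × v < suc m + l
  ⇒ v∈ with i , i<l , refl ← ∈-applyDownFrom⁻ (λ i → suc (m + i)) v∈ =
    s≤s (m≤m+n m i) , s<s (+-monoʳ-< m i<l)
  ⇐ : suc m ≤ v × v < suc m + l → v ∈ seg m l
  ⇐ (m<v , v<) with i , refl ← m≤n⇒∃[o]m+o≡n m<v =
    ∈-applyDownFrom⁺ _ (+-cancelˡ-< (suc m) i l v<)

seg-descending : ∀ m l → AllPairs _>_ (seg m l)
seg-descending m l = AllPairs.applyDownFrom⁺₁ _ l λ j<i _ → s<s (+-monoʳ-< m j<i)

seg-++ : ∀ m l → seg m l ++ seg 0 m ≡ seg 0 (l + m)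
seg-++ m zero    = refl
seg-++ m (suc l) = cong₂ _∷_ (cong suc (+-comm m l)) (seg-++ m l)

seg-↭ : ∀ n → seg 0 n ↭ applyUpTo suc n
seg-↭ n = ↭-trans (↭-reflexive (sym (reverse-applyUpTo suc n))) (↭-reverse _)

descending-unique : ∀ {xs ys} → AllPairs _≥_ xs → AllPairs _≥_ ys → xs ↭ ys → xs ≡ ys
descending-unique xs↘ ys↘ xs↭ys = Pointwise-≡⇒≡
  (↗↭↗⇒≋ ≥-order (AllPairs⇒Sorted ≥-order xs↘) (AllPairs⇒Sorted ≥-order ys↘) (↭⇒↭ₛ xs↭ys))
  where ≥-order = Flip.totalOrder ≤-totalOrder

minimum-least : ∀ {v c} → v ∈ c → All (v ≤_) c → minimum c ≡ v
minimum-least {c = x ∷ xs} (here refl) (v≤x ∷ v≤xs) = ≤-antisym (min≤⊤ x xs) (v≤min⁺ v≤x v≤xs)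
minimum-least (there v∈xs) (v≤x ∷ v≤xs) = min≈v⁺ v∈xs v≤xs v≤x

-- Avoidance of 123 and 312

-- The bounds are weak so that they follow from avoidance by mere negation; strictness is recovered
-- later from distinctness.
Straddle : ℕ → ℕ → ℕ → Set
Straddle a b c = b < c → b ≤ a × a ≤ c

data Straddled : List ℕ → Set where
  []  : Straddled []
  _∷_ : ∀ {a w} → AllPairs (Straddle a) w → Straddled w → Straddled (a ∷ w)

lookup-AllPairs : ∀ {R : ℕ → ℕ → Set} {w} → AllPairs R w →
                  ∀ {i j} → i <ᶠ j → R (lookup w i) (lookup w j)
lookup-AllPairs {w = _ ∷ w} (Ra ∷ _) {zero} {suc j} _ = All.lookup Ra (∈-lookup {xs = w} j)
lookup-AllPairs (_ ∷ Rw) {suc i} {suc j} (s<s p) = lookup-AllPairs Rw p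

lookup-Straddled : ∀ {w} → Straddled w → ∀ {i j k} → i <ᶠ j → j <ᶠ k →
                   Straddle (lookup w i) (lookup w j) (lookup w k)
lookup-Straddled (aw ∷ _) {zero}  {suc j} {suc k} _       (s<s q) = lookup-AllPairs aw q
lookup-Straddled (_ ∷ sw) {suc i} {suc j} {suc k} (s<s p) (s<s q) = lookup-Straddled sw p q

Straddled-lookup : ∀ w → (∀ {i j k} → i <ᶠ j → j <ᶠ k →
                   Straddle (lookup w i) (lookup w j) (lookup w k)) → Straddled w
Straddled-lookup []      _ = []
Straddled-lookup (a ∷ w) h =
  subst (AllPairs (Straddle a)) (tabulate-lookup w)
    (AllPairs.tabulate⁺-< λ {j} {k} p → h {zero} {suc j} {suc k} z<s (s<s p))
  ∷ Straddled-lookup w (λ p q → h (s<s p) (s<s q))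

contains-triple : ∀ τ {x y z} {i j k : Fin (length τ)} → i <ᶠ j → j <ᶠ k →
  (lookup τ i < lookup τ j) ⇔ (x < y) →
  (lookup τ i < lookup τ k) ⇔ (x < z) →
  (lookup τ j < lookup τ k) ⇔ (y < z) → Contains τ (x ∷ y ∷ z ∷ [])
contains-triple τ {x} {y} {z} {i} {j} {k} i<j j<k xy xz yz = f , f-mono , f-order
  where
  f : Fin 3 → Fin (length τ)
  f zero             = i
  f (suc zero)       = j
  f (suc (suc zero)) = k

  f-mono : ∀ a b → a <ᶠ b → f a <ᶠ f b
  f-mono zero       (suc zero)       _ = i<j
  f-mono zero       (suc (suc zero)) _ = <-trans i<j j<k
  f-mono (suc zero) (suc (suc zero)) _ = j<k
  f-mono (suc zero)       (suc zero)       (s<s ())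
  f-mono (suc (suc zero)) (suc zero)       (s<s ())
  f-mono (suc (suc zero)) (suc (suc zero)) (s<s (s<s ()))

  f-order : ∀ a b → a <ᶠ b →
            (lookup τ (f a) < lookup τ (f b)) ⇔
            (lookup (x ∷ y ∷ z ∷ []) a < lookup (x ∷ y ∷ z ∷ []) b)
  f-order zero       (suc zero)       _ = xy
  f-order zero       (suc (suc zero)) _ = xz
  f-order (suc zero) (suc (suc zero)) _ = yz
  f-order (suc zero)       (suc zero)       (s<s ())
  f-order (suc (suc zero)) (suc zero)       (s<s ())
  f-order (suc (suc zero)) (suc (suc zero)) (s<s (s<s ()))

-- For an ascent `b < c` after `a`, having `a < b` would give 123 and having `c < a` would give 312.
avoids⇒straddled : ∀ {τ} → Avoids τ p123 → Avoids τ p312 → Straddled τ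
avoids⇒straddled {τ} no123 no312 = Straddled-lookup τ λ i<j j<k b<c →
    ≮⇒≥ (λ a<b → no123 (contains-triple τ i<j j<k
      (mk⇔ (λ _ → ≤-refl) (λ _ → a<b))
      (mk⇔ (λ _ → s<s z<s) (λ _ → <-trans a<b b<c))
      (mk⇔ (λ _ → ≤-refl) (λ _ → b<c))))
  , ≮⇒≥ (λ c<a → no312 (contains-triple τ i<j j<k
      (mk⇔ (λ a<b → ⊥-elim (<-asym a<b (<-trans b<c c<a))) (λ { (s<s ()) }))
      (mk⇔ (λ a<c → ⊥-elim (<-asym a<c c<a)) (λ { (s<s (s<s ())) }))
      (mk⇔ (λ _ → ≤-refl) (λ _ → b<c))))

straddled⇒avoids-123 : ∀ {τ} → Straddled τ → Avoids τ p123
straddled⇒avoids-123 sτ (f , mono , order) = <⇒≱ a<b b≤a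
  where
  i<j = mono zero (suc zero) z<s
  j<k = mono (suc zero) (suc (suc zero)) (s<s z<s)
  a<b = from (order zero (suc zero) z<s) (s<s z<s)
  b<c = from (order (suc zero) (suc (suc zero)) (s<s z<s)) (s<s (s<s z<s))
  b≤a = proj₁ (lookup-Straddled sτ i<j j<k b<c)

-- An occurrence of 312 only says that `a < c` fails, and `Straddle` only that `a ≤ c`. Distinctness
-- rules out the remaining case `a ≡ c`, as in 2, 1, 2.
straddled⇒avoids-312 : ∀ {τ} → Unique τ → Straddled τ → Avoids τ p312
straddled⇒avoids-312 τ! sτ (f , mono , order) = a≮c (≤∧≢⇒< a≤c (lookup-AllPairs τ! (<-trans i<j j<k)))
  where
  i<j = mono zero (suc zero) z<s
  j<k = mono (suc zero) (suc (suc zero)) (s<s z<s)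
  b<c = from (order (suc zero) (suc (suc zero)) (s<s z<s)) (s<s z<s)
  a≤c = proj₂ (lookup-Straddled sτ i<j j<k b<c)
  a≮c = λ a<c → <⇒≱ (to (order zero (suc (suc zero)) z<s) a<c) (s≤s (s≤s z≤n))

-- Inserting a block

-- The block `U` is placed somewhere in `y , … , 1`: `here` places it now, `there` first lets the
-- largest remaining small value pass. For nonempty `U` there are `y + 1` places.
data Insertion (U : List ℕ) : ℕ → List ℕ → Set where
  here  : ∀ {y} → Insertion U y (U ++ seg 0 y)
  there : ∀ {y w} → Insertion U y w → Insertion U (suc y) (suc y ∷ w)

insertion-↭ : ∀ {U y w} → Insertion U y w → w ↭ U ++ seg 0 y
insertion-↭ here = ↭-refl
insertion-↭ {U} {suc y} (there ins) = ↭-trans (prep _ (insertion-↭ ins)) (↭-sym (shift (suc y) U (seg 0 y)))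

descending⇒straddle : ∀ {a w} → AllPairs _>_ w → AllPairs (Straddle a) w
descending⇒straddle = AllPairs.map λ b>c b<c → ⊥-elim (<-asym b>c b<c)

descending⇒straddled : ∀ {w} → AllPairs _>_ w → Straddled w
descending⇒straddled []         = []
descending⇒straddled (_ ∷ w↘) = descending⇒straddle w↘ ∷ descending⇒straddled w↘

-- The top of an ascent would have to reach `a`.
below-straddle⇒descending : ∀ {a w} → All (_< a) w → AllPairs (Straddle a) w → AllPairs _≥_ w
below-straddle⇒descending []         []         = []
below-straddle⇒descending (_ ∷ w<a) (bw ∷ sw) =
  All.zipWith (λ { (c<a , s) → ≮⇒≥ λ b<c → <⇒≱ c<a (proj₂ (s b<c)) }) (w<a , bw)
  ∷ below-straddle⇒descending w<a sw

module _ {x : ℕ} {U : List ℕ} (x<U : All (x <_) U) (U↘ : AllPairs _>_ U) where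

  block-descending : ∀ {y} → y ≤ x → AllPairs _>_ (U ++ seg 0 y)
  block-descending y≤x = AllPairs.++⁺ U↘ (seg-descending 0 _)
    (All.map (λ x<u → All.tabulate λ v∈ → ≤-<-trans (≤-trans (≤-pred (proj₂ (to ∈-seg v∈))) y≤x) x<u) x<U)

  insertion-unique : ∀ {y w} → y ≤ x → Insertion U y w → Unique w
  insertion-unique y≤x ins = ↭ₛ.Unique-resp-↭ (setoid ℕ) (↭⇒↭ₛ (↭-sym (insertion-↭ ins)))
    (AllPairs.map >⇒≢ (block-descending y≤x))

  insertion-gap : ∀ {y w} → Insertion U y w → All (λ v → v ≤ y ⊎ x < v) w
  insertion-gap ins = All.tabulate λ v∈w → gap (∈-++⁻ U (∈-resp-↭ (insertion-↭ ins) v∈w))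
    where
    gap : ∀ {v y} → v ∈ U ⊎ v ∈ seg 0 y → v ≤ y ⊎ x < v
    gap (inj₁ v∈U)   = inj₂ (All.lookup x<U v∈U)
    gap (inj₂ v∈seg) = inj₁ (≤-pred (proj₂ (to ∈-seg v∈seg)))

  -- The small values and the block each descend, so an ascent starts at a value at most `y` and
  -- ends in the block, above `x`. Any `a` with `y < a ≤ x` lies between.
  insertion-straddle : ∀ {y w a} → y < a → a ≤ x → Insertion U y w → AllPairs (Straddle a) w
  insertion-straddle y<a a≤x here = descending⇒straddle (block-descending (<⇒≤ (<-≤-trans y<a a≤x)))
  insertion-straddle {suc y} {a = a} y<a a≤x (there ins) =
    All.map straddle (insertion-gap ins) ∷ insertion-straddle (<⇒≤ y<a) a≤x ins
    where
    straddle : ∀ {c} → c ≤ y ⊎ x < c → Straddle a (suc y) c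
    straddle (inj₁ c≤y) y<c = ⊥-elim (<⇒≱ y<c (m≤n⇒m≤1+n c≤y))
    straddle (inj₂ x<c) _   = <⇒≤ y<a , <⇒≤ (≤-<-trans a≤x x<c)

  insertion-straddled : ∀ {y w} → y ≤ x → Insertion U y w → Straddled w
  insertion-straddled y≤x here        = descending⇒straddled (block-descending y≤x)
  insertion-straddled y≤x (there ins) =
    insertion-straddle ≤-refl y≤x ins ∷ insertion-straddled (<⇒≤ y≤x) ins

  -- Here `x` is an entry that precedes `w`. The first entry of `w`, if any, decides the
  -- constructor: `here` if it belongs to the block, `there` otherwise.
  straddled⇒insertion : ∀ {y w} → y < x → w ↭ U ++ seg 0 y →
                        AllPairs (Straddle x) w → Straddled w → Insertion U y w
  straddled⇒insertion {w = []} y<x p _ _ = subst (Insertion U _) (↭-empty-inv (↭-sym p)) here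
  straddled⇒insertion {y} {z ∷ w} y<x p (xz ∷ xw) (zw ∷ sw)
    with ∈-++⁻ U (∈-resp-↭ p (here refl))
  -- An ascent starting at `z` would force `z ≤ x`, so `z` bounds `w`. Then `Straddle z` makes `w`
  -- descend, and the order of all remaining entries is fixed.
  ... | inj₁ z∈U = subst (Insertion U y) (sym block) here
    where
    z∷w! : Unique (z ∷ w)
    z∷w! = ↭ₛ.Unique-resp-↭ (setoid ℕ) (↭⇒↭ₛ (↭-sym p)) (AllPairs.map >⇒≢ (block-descending (<⇒≤ y<x)))
    w≤z : All (_≤ z) w
    w≤z = All.map (λ s → ≮⇒≥ λ z<c → <⇒≱ (All.lookup x<U z∈U) (proj₁ (s z<c))) xz
    w<z : All (_< z) w
    w<z = All.zipWith (λ { (c≤z , z≢c) → ≤∧≢⇒< c≤z (z≢c ∘ sym) }) (w≤z , AllPairs.head z∷w!)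
    block : z ∷ w ≡ U ++ seg 0 y
    block = descending-unique (w≤z ∷ below-straddle⇒descending w<z zw)
      (AllPairs.map <⇒≤ (block-descending (<⇒≤ y<x))) p
  straddled⇒insertion {suc y} {z ∷ w} y<x p (xz ∷ xw) (zw ∷ sw) | inj₂ z∈seg
    -- A small `z` must be `suc y`: otherwise `suc y` comes later and forms with `z` an ascent whose
    -- top is below `x`.
    with ∈-resp-↭ (↭-sym p) (∈-++⁺ʳ U (here refl))
  ... | here refl = there (straddled⇒insertion (<⇒≤ y<x) (drop-mid [] U p) xw sw)
  ... | there y∈w with m≤n⇒m<n∨m≡n (≤-pred (proj₂ (to ∈-seg z∈seg)))
  ...   | inj₁ z<y  = ⊥-elim (<⇒≱ y<x (proj₂ (All.lookup xz y∈w z<y)))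
  ...   | inj₂ refl = there (straddled⇒insertion (<⇒≤ y<x) (drop-mid [] U p) xw sw)

-- Counting completions of a prefix

-- With an empty block all places of insertion give the same list, so this case is counted apart.
insertion-[] : ∀ {y w} → Insertion [] y w → w ≡ seg 0 y
insertion-[] here        = refl
insertion-[] (there ins) = cong (_ ∷_) (insertion-[] ins)

insertion-zero : ∀ {U w} → Insertion U 0 w → w ≡ U ++ []
insertion-zero here = refl

Completion : List ℕ → ℕ → List ℕ → Pred (List ℕ) _
Completion U y c w = Insertion U y w × take (length c) w ≡ c

-- In the second case c = (y , y - 1 , … , m + 1), so the insertion point is still open.
Size : ℕ → List ℕ → ℕ → Set
Size y c k = k ∈ 0 ∷ 1 ∷ [] ⊎ ∃[ m ] k ≡ suc m × y ≡ m + length c × c ≡ seg m (length c)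

completion-block? : ∀ U y c → Dec (Completion U y c (U ++ seg 0 y))
completion-block? U y c = map′ (here ,_) proj₂ (≡-dec _≟_ _ c)

module _ {u : ℕ} (U : List ℕ) where

  -- The bound `y < u` keeps the places distinct: `here` gives a list starting with `u`, `there` one
  -- starting with the largest small value.
  card-insertions : ∀ y → y < u → HasCardinality (Insertion (u ∷ U) y) (suc y)
  card-insertions zero    _   =
    (u ∷ U ++ []) ∷ [] , [] ∷ [] , refl , λ _ → mk⇔ (λ { (here refl) → here }) (here ∘ insertion-zero)
  card-insertions (suc y) y<u = card-cong
    (λ w → mk⇔ (λ { (inj₁ refl) → here ; (inj₂ (_ , refl , ins)) → there ins })
               (λ { here → inj₁ refl ; (there ins) → inj₂ (_ , refl , ins) }))
    (card-insert (λ { (_ , refl , _) → <-irrefl refl y<u })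
      (card-map-∷ (suc y) (card-insertions y (<⇒≤ y<u))))

  card-completions : ∀ y c → y < u →
    ∃[ k ] HasCardinality (Completion (u ∷ U) y c) k ×
    Size y c k
  card-completions y [] y<u =
    suc y , card-cong (λ _ → mk⇔ (_, refl) proj₁) (card-insertions y y<u) ,
    -- With no prefix left to match, every place is open, and `m` is `y` itself.
    inj₂ (y , refl , sym (+-identityʳ y) , refl)
  card-completions zero c@(_ ∷ _) _
    with k , card , k≤1 ← card-⊆-singleton _ (insertion-zero ∘ proj₁) (completion-block? (u ∷ U) 0 c)
    = k , card , inj₁ k≤1
  card-completions (suc y) (z ∷ c) y<u with z ≟ suc y
  -- The prefix leaves the descending run, so only inserting the block now can match it.
  ... | no z≢y
    with k , card , k≤1 ← card-⊆-singleton _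
           (λ { (here , _) → refl ; (there _ , eq) → ⊥-elim (z≢y (sym (∷-injectiveˡ eq))) })
           (completion-block? (u ∷ U) (suc y) (z ∷ c))
    = k , card , inj₁ k≤1
  -- The prefix follows the run; the block cannot come now, since its head `u` exceeds `suc y`.
  ... | yes refl
    with k , card , size ← card-completions y c (<⇒≤ y<u)
    = k , card-cong
        (λ w → mk⇔ (λ { (_ , refl , ins , eq) → there ins , cong (_ ∷_) eq })
                   (λ { (here , eq) → ⊥-elim (<-irrefl (sym (∷-injectiveˡ eq)) y<u)
                      ; (there ins , eq) → _ , refl , ins , ∷-injectiveʳ eq }))
        (card-map-∷ (suc y) card) , extend size
    where
    extend : ∀ {k} → Size y c k → Size (suc y) (suc y ∷ c) k
    extend (inj₁ k≤1) = inj₁ k≤1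
    extend (inj₂ (m , k≡ , y≡ , c≡)) =
      inj₂ (m , k≡ , trans (cong suc y≡) (sym (+-suc m _)) , cong₂ _∷_ (cong suc y≡) c≡)

-- Permutations with a prescribed prefix

-- The first entry `suc x` splits the other values into the `l` larger ones, which form the block,
-- and the smaller ones `x , … , 1`. The whole permutation is itself an insertion into
-- `suc x , … , 1`, of the form `there ins`.
S⇔completion : ∀ x l c τ →
  (∃[ w ] τ ≡ suc x ∷ w × Completion (seg (suc x) l) x c w) ⇔
  S (suc x + l) (suc x ∷ c) (p123 ∷ p312 ∷ []) τ
S⇔completion x l c τ = mk⇔ ⇒ (⇐ τ)
  where
  U = seg (suc x) l

  x<U : All (suc x <_) U
  x<U = All.tabulate (proj₁ ∘ to ∈-seg)

  U↘ : AllPairs _>_ U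
  U↘ = seg-descending (suc x) l

  range : U ++ seg 0 (suc x) ↭ applyUpTo suc (suc x + l)
  range = ↭-trans (↭-reflexive (trans (seg-++ (suc x) l) (cong (seg 0) (+-comm l (suc x))))) (seg-↭ _)

  ⇒ : (∃[ w ] τ ≡ suc x ∷ w × Completion U x c w) → S (suc x + l) (suc x ∷ c) (p123 ∷ p312 ∷ []) τ
  ⇒ (w , refl , ins , eq) =
      ↭-trans (insertion-↭ (there ins)) range , cong (suc x ∷_) eq
    , straddled⇒avoids-123 sτ ∷ straddled⇒avoids-312 (insertion-unique x<U U↘ ≤-refl (there ins)) sτ ∷ []
    where sτ = insertion-straddled x<U U↘ ≤-refl (there ins)

  ⇐ : ∀ τ → S (suc x + l) (suc x ∷ c) (p123 ∷ p312 ∷ []) τ → ∃[ w ] τ ≡ suc x ∷ w × Completion U x c w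
  ⇐ (_ ∷ w) (perm , eq , no123 ∷ no312 ∷ [])
    with refl ← ∷-injectiveˡ eq
    with xw ∷ sw ← avoids⇒straddled no123 no312
    = w , refl , straddled⇒insertion x<U U↘ ≤-refl (drop-mid [] U (↭-trans perm (↭-sym range))) xw sw , ∷-injectiveʳ eq

seg-consecutive : ∀ {m c} → c ≡ seg m (length c) → Consecutive c
seg-consecutive {m} {c} c≡ = suc m , λ v →
  mk⇔ (to ∈-seg ∘ subst (v ∈_) c≡) (subst (v ∈_) (sym c≡) ∘ from ∈-seg)

seg-minimum : ∀ m l → minimum (seg m (suc l)) ≡ suc m
seg-minimum m l = minimum-least {c = seg m (suc l)}
  (from (∈-seg {m} {suc l}) (≤-refl , s<s (m<m+n m z<s)))
  (All.tabulate (proj₁ ∘ to (∈-seg {m} {suc l})))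

theorem5p8 : (n t : ℕ) → 3 ≤ n → 1 ≤ t → t < n →
    (c : List ℕ) → length c ≡ t →
    All (λ m → 1 ≤ m × m ≤ n) c → Unique c →
    Avoids c p123 → Avoids c p312 →
    ∃[ k ] HasCardinality (S n c (p123 ∷ p312 ∷ [])) k ×
    (Consecutive c → k ∈ (0 ∷ 1 ∷ minimum c ∷ [])) ×
    (¬ Consecutive c → k ∈ (0 ∷ 1 ∷ []))
theorem5p8 n t _ () _ [] refl _ _ _ _
theorem5p8 n t _ _ _ (suc x ∷ c) _ ((_ , x≤n) ∷ _) _ _ _
  with l , refl ← m≤n⇒∃[o]m+o≡n x≤n = conclude (count l)
  where
  count : ∀ l → ∃[ k ] HasCardinality (Completion (seg (suc x) l) x c) k ×
    Size x c k
  -- The first entry is `n`, so the block is empty.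
  count zero
    with k , card , k≤1 ← card-⊆-singleton _ (insertion-[] ∘ proj₁) (completion-block? [] x c)
    = k , card , inj₁ k≤1
  count (suc l) = card-completions _ x c (s<s (m≤n⇒m≤n+o l (n≤1+n x)))

  conclude : ∀ {l} → ∃[ k ] HasCardinality (Completion (seg (suc x) l) x c) k ×
    Size x c k →
    ∃[ k ] HasCardinality (S (suc x + l) (suc x ∷ c) (p123 ∷ p312 ∷ [])) k ×
    (Consecutive (suc x ∷ c) → k ∈ (0 ∷ 1 ∷ minimum (suc x ∷ c) ∷ [])) ×
    (¬ Consecutive (suc x ∷ c) → k ∈ (0 ∷ 1 ∷ []))
  conclude {l} (k , card , size) =
    k , card-cong (S⇔completion x l c) (card-map-∷ (suc x) card) , consecutive size , otherwise size
    where
    prefix : ∀ {m} → x ≡ m + length c → c ≡ seg m (length c) → suc x ∷ c ≡ seg m (suc (length c))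
    prefix x≡ c≡ = cong₂ _∷_ (cong suc x≡) c≡

    consecutive : Size x c k → Consecutive (suc x ∷ c) → k ∈ (0 ∷ 1 ∷ minimum (suc x ∷ c) ∷ [])
    consecutive (inj₁ (here k≡0)) _ = here k≡0
    consecutive (inj₁ (there (here k≡1))) _ = there (here k≡1)
    consecutive (inj₂ (m , k≡ , x≡ , c≡)) _ =
      -- The prefix ends at `m + 1`, which is both its minimum and the number of open places.
      there (there (here (trans k≡ (sym (trans (cong minimum (prefix x≡ c≡)) (seg-minimum m (length c)))))))

    otherwise : Size x c k → ¬ Consecutive (suc x ∷ c) → k ∈ (0 ∷ 1 ∷ [])
    otherwise (inj₁ k≤1) _ = k≤1
    -- The place of insertion stays open only for a prefix that is a descending run, hence
    -- consecutive.
    otherwise (inj₂ (_ , _ , x≡ , c≡)) ¬consecutive = ⊥-elim (¬consecutive (seg-consecutive (prefix x≡ c≡)))
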